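{- Let $G=(V,E)$ be a simple undirected graph with $n$ vertices, $m$ edges and average degree $\bar d = 2m/n$. Let $v$ be chosen uniformly at random from $V$ and, independently, $\pi$ be chosen uniformly at random from $\Pi$. Then $$\mathbb{E}_{v \sim V,\, \pi \sim \Pi}[T(v,\pi)] = O(\bar d \cdot \log n),$$ where the constant hidden in $O(\cdot)$ is absolute (independent of $G$).
   Context: $\Pi$ denotes the set of all $m!$ bijections $\pi : E \to \{1,\dots,m\}$; $\pi(e)$ is called the rank of $e$. For $\pi\in\Pi$, $\mathrm{GMM}(G,\pi)$ is the matching obtained by scanning the edges in increasing order of rank and adding each scanned edge whose two endpoints are both currently unmatched. Vertex oracle $\mathrm{VO}(v,\pi)$: let $e_1=(v,u_1),\dots,e_k=(v,u_k)$ be the edges incident to $v$ with $\pi(e_1)<\dots<\pi(e_k)$; for $i=1,\dots,k$, if $\mathrm{EO}(e_i,u_i,\pi)$ returns true then return true; after the loop return false. Edge oracle $\mathrm{EO}(e,u,\pi)$, where $u$ is an endpoint of $e$: if $\mathrm{EO}(e,u,\pi)$ has already been computed during the current execution of the top-level vertex oracle call, return the stored answer (making no further calls). Otherwise let $e_1=(u,w_1),\dots,e_k=(u,w_k)$ be the edges incident to $u$ with $\pi(e_i)<\pi(e)$ and $\pi(e_1)<\dots<\pi(e_k)$; for $i=1,\dots,k$, if $\mathrm{EO}(e_i,w_i,\pi)$ returns true then return false; after the loop return true. $T(v,\pi)$ is the total number of calls to the edge oracle (counting also calls answered from the stored values) made during the execution of $\mathrm{VO}(v,\pi)$. -}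

module Defs where

open import Data.Nat using (ℕ; zero; suc; _+_; _*_; _≤_; _!)
open import Data.Nat.Logarithm using (⌈log₂_⌉)
open import Data.Fin using (Fin; _≟_)
open import Data.Fin.Base using () renaming (zero to fzero)
open import Data.Bool using (Bool; true; false; if_then_else_; _∨_; _∧_; not)
open import Data.List using (List; []; _∷_; map; concatMap; filterᵇ; allFin)
open import Data.Nat.ListAction using (sum)
open import Data.Maybe using (Maybe; just; nothing)
open import Data.Product using (Σ; _×_; _,_; proj₁; proj₂)
open import Data.Sum using (_⊎_)
open import Relation.Nullary using (¬_; does)
open import Relation.Binary.PropositionalEquality using (_≡_; _≢_)

SameEnds : {n : ℕ} → Fin n × Fin n → Fin n × Fin n → Set
SameEnds (a , b) (c , d) = (a ≡ c × b ≡ d) ⊎ (a ≡ d × b ≡ c)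

record Graph : Set where
  field
    n     : ℕ
    m     : ℕ
    edge  : Fin m → Fin n × Fin n
    noLoop  : ∀ i → proj₁ (edge i) ≢ proj₂ (edge i)
    noMulti : ∀ i j → i ≢ j → ¬ SameEnds (edge i) (edge j)

insertions : {A : Set} → A → List A → List (List A)
insertions x [] = (x ∷ []) ∷ []
insertions x (y ∷ ys) = (x ∷ y ∷ ys) ∷ map (y ∷_) (insertions x ys)

perms : {A : Set} → List A → List (List A)
perms [] = [] ∷ []
perms (x ∷ xs) = concatMap (insertions x) (perms xs)

-- A rank function π : E → {1..m} (bijection) is represented by the list of
-- edges in increasing order of rank; π(e) = 1 + position of e in the list.
-- The m! bijections Π correspond to perms (allFin m).
Ordering : Graph → Set
Ordering G = List (Fin (Graph.m G))

module Oracle (G : Graph) (ord : Ordering G) where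
  open Graph G

  eqF : {k : ℕ} → Fin k → Fin k → Bool
  eqF a b = does (a ≟ b)

  incident : Fin n → Fin m → Bool
  incident u f = eqF (proj₁ (edge f)) u ∨ eqF (proj₂ (edge f)) u

  other : Fin m → Fin n → Fin n
  other f u = if eqF (proj₁ (edge f)) u then proj₂ (edge f) else proj₁ (edge f)

  before : Fin m → List (Fin m) → List (Fin m)
  before e [] = []
  before e (f ∷ fs) = if eqF f e then [] else f ∷ before e fs

  Memo : Set
  Memo = List (Fin m × Fin n × Bool)

  lookupMemo : Fin m → Fin n → Memo → Maybe Bool
  lookupMemo e u [] = nothing
  lookupMemo e u ((f , w , b) ∷ ms) =
    if eqF f e ∧ eqF w u then just b else lookupMemo e u ms

  -- Results: (answer , memo table afterwards , number of EO calls made).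
  -- The ℕ argument is fuel; each nested call strictly decreases the rank,
  -- so fuel (suc m) at top level is never exhausted.
  mutual
    eo : ℕ → Fin m → Fin n → Memo → Bool × Memo × ℕ
    eo fuel e u memo with lookupMemo e u memo
    ... | just b = b , memo , 1
    eo zero e u memo | nothing = true , memo , 1
    eo (suc k) e u memo | nothing with loop k (filterᵇ (incident u) (before e ord)) u memo
    ... | found , memo' , c = not found , ((e , u , not found) ∷ memo') , suc c

    loop : ℕ → List (Fin m) → Fin n → Memo → Bool × Memo × ℕ
    loop k [] u memo = false , memo , 0
    loop k (f ∷ fs) u memo with eo k f (other f u) memo
    ... | true  , memo₁ , c₁ = true , memo₁ , c₁
    ... | false , memo₁ , c₁ with loop k fs u memo₁
    ...   | b₂ , memo₂ , c₂ = b₂ , memo₂ , c₁ + c₂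

  vo : Fin n → Bool × Memo × ℕ
  vo v = loop (suc m) (filterᵇ (incident v) ord) v []

  T : Fin n → ℕ
  T v = proj₂ (proj₂ (vo v))

totalCalls : Graph → ℕ
totalCalls G =
  sum (map (λ ord → sum (map (Oracle.T G ord) (allFin (Graph.n G))))
           (perms (allFin (Graph.m G))))

{-# OPTIONS --safe #-}

-- Without the memo table the calls can be counted by letting the edges arrive in
-- rank order: when g = (x , y) arrives while x is unmatched, the number of calls
-- made from x grows by 1 plus the number made from y so far. By linearity, each
-- arrival of an edge e at an unmatched endpoint u launches a token at u, and a
-- token at x spawns a copy at y whenever (x , y) arrives with y unmatched; the
-- total is the number of tokens ever alive.
--
-- For a fixed pair (e , u), the tokens summed over all orderings of k + 1 edges
-- number at most (k + 1)!, by induction on k. If e comes first, the token at u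
-- survives in all k ! orderings and, by induction, gets at most k ! copies
-- through each edge g = (u , y) whose y is still unmatched. If some g comes first
-- instead and does not match u, induction gives at most k !. The same g cannot
-- contribute in both ways, since an edge with two unmatched endpoints matches u.
-- Hence the expected total over all vertices is at most 2m, even without the
-- factor log n.
module Submission where

open import Defs
open import Algebra.Properties.CommutativeSemigroup using (interchange)
open import Data.Bool using (Bool; true; false; if_then_else_; _∨_; _∧_; not)
open import Data.Bool.Properties using (∨-identityʳ)
open import Data.Empty using (⊥-elim)
open import Data.Fin using (Fin; _≟_) renaming (zero to fzero)
open import Data.List using (List; []; _∷_; [_]; _++_; _ʳ++_; reverse; map; concatMap; filterᵇ; allFin; length)
open import Data.List.Membership.Propositional using (_∈_; _∉_; find)
open import Data.List.Membership.Propositional.Properties using (∈-allFin; ∈-map⁻; ∈-concatMap⁻; ∈-++⁺ʳ)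
open import Data.List.Properties using (map-++; map-∘; length-reverse; length-tabulate; ʳ++-defn; reverse-involutive; ++-identityʳ)
open import Data.List.Relation.Binary.Permutation.Propositional using (_↭_; ↭-refl; ↭-trans; prep; swap; ↭⇒↭ₛ)
open import Data.List.Relation.Binary.Permutation.Propositional.Properties using (↭-length)
open import Data.List.Relation.Binary.Permutation.Setoid.Properties using (Unique-resp-↭)
open import Data.List.Relation.Unary.All using (_∷_)
open import Data.List.Relation.Unary.All.Properties using (All¬⇒¬Any)
open import Data.List.Relation.Unary.Any using (here; there)
open import Data.List.Relation.Unary.Unique.Propositional using (Unique; _∷_)
open import Data.List.Relation.Unary.Unique.Propositional.Properties using (allFin⁺)
open import Data.Maybe using (just; nothing)
open import Data.Nat using (ℕ; zero; suc; _+_; _*_; _≤_; _<_; z≤n; s≤s; _!)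
open import Data.Nat.ListAction using (sum)
open import Data.Nat.ListAction.Properties using (sum-++)
open import Data.Nat.Logarithm using (⌈log₂_⌉; ⌈log₂⌉-mono-≤)
open import Data.Nat.Properties hiding (_≟_)
open import Data.Product using (Σ; _×_; _,_; proj₁; proj₂)
open import Function using (_∘_; id)
open import Relation.Binary.PropositionalEquality hiding ([_])
open import Relation.Nullary using (yes; no; does)

private
  variable
    A B : Set

-- Finite sums over lists.

∑ : List A → (A → ℕ) → ℕ
∑ xs f = sum (map f xs)

∑-cong-∈ : ∀ {f g : A → ℕ} xs → (∀ x → x ∈ xs → f x ≡ g x) → ∑ xs f ≡ ∑ xs g
∑-cong-∈ []       h = refl
∑-cong-∈ (x ∷ xs) h = cong₂ _+_ (h x (here refl)) (∑-cong-∈ xs (λ y → h y ∘ there))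

∑-cong : ∀ {f g : A → ℕ} xs → (∀ x → f x ≡ g x) → ∑ xs f ≡ ∑ xs g
∑-cong xs h = ∑-cong-∈ xs (λ x _ → h x)

∑-mono-∈ : ∀ {f g : A → ℕ} xs → (∀ x → x ∈ xs → f x ≤ g x) → ∑ xs f ≤ ∑ xs g
∑-mono-∈ []       h = z≤n
∑-mono-∈ (x ∷ xs) h = +-mono-≤ (h x (here refl)) (∑-mono-∈ xs (λ y → h y ∘ there))

∑-mono : ∀ {f g : A → ℕ} xs → (∀ x → f x ≤ g x) → ∑ xs f ≤ ∑ xs g
∑-mono xs h = ∑-mono-∈ xs (λ x _ → h x)

+-interchange : ∀ a b c d → (a + b) + (c + d) ≡ (a + c) + (b + d)
+-interchange = interchange +-commutativeSemigroup

∑-distrib-+ : ∀ (f g : A → ℕ) xs → ∑ xs (λ x → f x + g x) ≡ ∑ xs f + ∑ xs g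
∑-distrib-+ f g []       = refl
∑-distrib-+ f g (x ∷ xs) =
  trans (cong (f x + g x +_) (∑-distrib-+ f g xs)) (+-interchange (f x) (g x) _ _)

∑-zero : ∀ {f : A → ℕ} xs → (∀ x → f x ≡ 0) → ∑ xs f ≡ 0
∑-zero []       h = refl
∑-zero (x ∷ xs) h = cong₂ _+_ (h x) (∑-zero xs h)

∑-map : ∀ (f : B → ℕ) (g : A → B) xs → ∑ (map g xs) f ≡ ∑ xs (f ∘ g)
∑-map f g xs = cong sum (sym (map-∘ xs))

∑-concatMap : ∀ (f : B → ℕ) (g : A → List B) xs →
              ∑ (concatMap g xs) f ≡ ∑ xs (λ x → ∑ (g x) f)
∑-concatMap f g []       = refl
∑-concatMap f g (x ∷ xs) = begin
  sum (map f (g x ++ concatMap g xs))         ≡⟨ cong sum (map-++ f (g x) _) ⟩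
  sum (map f (g x) ++ map f (concatMap g xs)) ≡⟨ sum-++ (map f (g x)) _ ⟩
  ∑ (g x) f + ∑ (concatMap g xs) f            ≡⟨ cong (∑ (g x) f +_) (∑-concatMap f g xs) ⟩
  ∑ (g x) f + ∑ xs (λ y → ∑ (g y) f)          ∎
  where open ≡-Reasoning

-- Sums over permutations, conditioned on the first entry.

selections : List A → List (A × List A)
selections []       = []
selections (x ∷ xs) = (x , xs) ∷ map (λ (y , ys) → y , x ∷ ys) (selections xs)

∑-selections : ∀ (f : A × List A → ℕ) x xs →
  ∑ (selections (x ∷ xs)) f ≡ f (x , xs) + ∑ (selections xs) (λ (y , ys) → f (y , x ∷ ys))
∑-selections f x xs = cong (f (x , xs) +_) (∑-map f _ (selections xs))

∑-selections-proj₁ : ∀ (f : A → ℕ) xs → ∑ (selections xs) (f ∘ proj₁) ≡ ∑ xs f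
∑-selections-proj₁ f []       = refl
∑-selections-proj₁ f (x ∷ xs) =
  trans (∑-selections (f ∘ proj₁) x xs) (cong (f x +_) (∑-selections-proj₁ f xs))

selections-length : ∀ (xs : List A) {p} → p ∈ selections xs → length xs ≡ suc (length (proj₂ p))
selections-length (x ∷ xs) (here refl) = refl
selections-length (x ∷ xs) (there p∈) with ∈-map⁻ _ p∈
... | _ , q∈ , refl = cong suc (selections-length xs q∈)

-- What remains after two removals does not depend on their order, so exchanging the two roles only
-- permutes the summands.
∑-selections-swap : ∀ (f : A → A → List A → ℕ) xs →
  ∑ (selections xs) (λ (y , ys) → ∑ (selections ys) (λ (z , zs) → f y z zs)) ≡
  ∑ (selections xs) (λ (y , ys) → ∑ (selections ys) (λ (z , zs) → f z y zs))
∑-selections-swap f []       = refl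
∑-selections-swap {A} f (x ∷ xs) = begin
  ∑ (selections (x ∷ xs)) (pairs f)            ≡⟨ expand f ⟩
  fst f + (snd f + rest f)                     ≡⟨ cong (λ t → fst f + (snd f + t)) (∑-selections-swap (λ y z zs → f y z (x ∷ zs)) xs) ⟩
  fst f + (snd f + rest f′)                    ≡⟨ sym (+-assoc (fst f) (snd f) _) ⟩
  (fst f + snd f) + rest f′                    ≡⟨ cong (_+ rest f′) (+-comm (fst f) (snd f)) ⟩
  (snd f + fst f) + rest f′                    ≡⟨ +-assoc (snd f) (fst f) _ ⟩
  fst f′ + (snd f′ + rest f′)                  ≡⟨ sym (expand f′) ⟩
  ∑ (selections (x ∷ xs)) (pairs f′)           ∎
  where
  open ≡-Reasoning
  f′ : A → A → List A → ℕ
  f′ y z = f z y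
  pairs : (A → A → List A → ℕ) → A × List A → ℕ
  pairs k (y , ys) = ∑ (selections ys) (λ (z , zs) → k y z zs)
  fst snd rest : (A → A → List A → ℕ) → ℕ
  fst k  = ∑ (selections xs) (λ (z , zs) → k x z zs)
  snd k  = ∑ (selections xs) (λ (y , ys) → k y x ys)
  rest k = ∑ (selections xs) (λ (y , ys) → ∑ (selections ys) (λ (z , zs) → k y z (x ∷ zs)))
  expand : ∀ k → ∑ (selections (x ∷ xs)) (pairs k) ≡ fst k + (snd k + rest k)
  expand k = trans (∑-selections (pairs k) x xs) (cong (fst k +_)
    (trans (∑-cong (selections xs) (λ (y , ys) → ∑-selections (λ (z , zs) → k y z zs) x ys))
           (∑-distrib-+ _ _ (selections xs))))

∑-perms-∷ : ∀ (f : List A → ℕ) x xs →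
  ∑ (perms (x ∷ xs)) f ≡ ∑ (perms xs) (λ ρ → ∑ (insertions x ρ) f)
∑-perms-∷ f x xs = ∑-concatMap f (insertions x) (perms xs)

∑-insertions-∷ : ∀ (f : List A → ℕ) x y ys →
  ∑ (insertions x (y ∷ ys)) f ≡ f (x ∷ y ∷ ys) + ∑ (insertions x ys) (f ∘ (y ∷_))
∑-insertions-∷ f x y ys = cong (f (x ∷ y ∷ ys) +_) (∑-map f (y ∷_) (insertions x ys))

-- An inserted x lands in front or behind the head y; the latter terms regroup into the permutations
-- of `x ∷ ys`. This turns enumeration by insertion into conditioning on the first arrival.
∑-perms-head : ∀ (f : List A → ℕ) x xs →
  ∑ (perms (x ∷ xs)) f ≡ ∑ (selections (x ∷ xs)) (λ (y , ys) → ∑ (perms ys) (f ∘ (y ∷_)))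
∑-perms-head f x []           = cong (_+ 0) (sym (+-identityʳ (f [ x ])))
∑-perms-head f x xs@(x′ ∷ xs′) = begin
  ∑ (perms (x ∷ xs)) f
    ≡⟨ ∑-perms-∷ f x xs ⟩
  ∑ (perms xs) (λ ρ → ∑ (insertions x ρ) f)
    ≡⟨ ∑-perms-head _ x′ xs′ ⟩
  ∑ (selections xs) (λ (y , ys) → ∑ (perms ys) (λ ρ → ∑ (insertions x (y ∷ ρ)) f))
    ≡⟨ ∑-cong (selections xs) (λ (y , ys) → trans
         (∑-cong (perms ys) (∑-insertions-∷ f x y))
         (∑-distrib-+ _ _ (perms ys))) ⟩
  ∑ (selections xs) (λ (y , ys) → ∑ (perms ys) (λ ρ → f (x ∷ y ∷ ρ)) +
                                  ∑ (perms ys) (λ ρ → ∑ (insertions x ρ) (f ∘ (y ∷_))))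
    ≡⟨ ∑-distrib-+ xFirst yFirst (selections xs) ⟩
  ∑ (selections xs) xFirst + ∑ (selections xs) yFirst
    ≡⟨ cong₂ _+_ (sym (∑-perms-head (f ∘ (x ∷_)) x′ xs′))
                 (∑-cong (selections xs) (λ (y , ys) → sym (∑-perms-∷ (f ∘ (y ∷_)) x ys))) ⟩
  ∑ (perms xs) (f ∘ (x ∷_)) +
  ∑ (selections xs) (λ (y , ys) → ∑ (perms (x ∷ ys)) (f ∘ (y ∷_)))
    ≡⟨ sym (∑-selections (λ (y , ys) → ∑ (perms ys) (f ∘ (y ∷_))) x xs) ⟩
  ∑ (selections (x ∷ xs)) (λ (y , ys) → ∑ (perms ys) (f ∘ (y ∷_)))
    ∎
  where
  open ≡-Reasoning
  xFirst yFirst : _ × List _ → ℕ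
  xFirst (y , ys) = ∑ (perms ys) (λ ρ → f (x ∷ y ∷ ρ))
  yFirst (y , ys) = ∑ (perms ys) (λ ρ → ∑ (insertions x ρ) (f ∘ (y ∷_)))

∑-selections-const : ∀ c (xs : List A) → ∑ (selections xs) (λ _ → c) ≡ length xs * c
∑-selections-const c xs = begin
  ∑ (selections xs) (λ _ → c)      ≡⟨ ∑-selections-proj₁ (λ _ → c) xs ⟩
  ∑ xs (λ _ → c)                   ≡⟨ ∑-const xs ⟩
  length xs * c                    ∎
  where
  open ≡-Reasoning
  ∑-const : ∀ ys → ∑ ys (λ _ → c) ≡ length ys * c
  ∑-const []       = refl
  ∑-const (y ∷ ys) = cong (c +_) (∑-const ys)

-- The remainders in `selections` are not subterms, so the recursion runs on the length k.
∑-perms-one : ∀ k (xs : List A) → length xs ≡ k → ∑ (perms xs) (λ _ → 1) ≡ k !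
∑-perms-one .0      []           refl = refl
∑-perms-one (suc k) xs@(x ∷ xs′) eq   = begin
  ∑ (perms xs) (λ _ → 1)
    ≡⟨ ∑-perms-head _ x xs′ ⟩
  ∑ (selections xs) (λ (_ , ys) → ∑ (perms ys) (λ _ → 1))
    ≡⟨ ∑-cong-∈ (selections xs) (λ (_ , ys) q∈ → ∑-perms-one k ys
         (suc-injective (trans (sym (selections-length xs q∈)) eq))) ⟩
  ∑ (selections xs) (λ _ → k !)
    ≡⟨ ∑-selections-const (k !) xs ⟩
  length xs * k !
    ≡⟨ cong (_* k !) eq ⟩
  suc k !
    ∎
  where open ≡-Reasoning

-- Sums over the ways to write ρ = l ++ g ∷ r, respectively ρ = l ++ r; the second
-- argument is p with l pushed onto it, hence reversed.
∑splits : (A → List A → List A → ℕ) → List A → List A → ℕ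
∑splits F p []      = 0
∑splits F p (g ∷ ρ) = F g p ρ + ∑splits F (g ∷ p) ρ

∑cuts : (List A → List A → ℕ) → List A → List A → ℕ
∑cuts F p []      = F p []
∑cuts F p (g ∷ ρ) = F p (g ∷ ρ) + ∑cuts F (g ∷ p) ρ

∑-perms-∑cuts : ∀ (F : List A → List A → ℕ) p xs →
  ∑ (perms xs) (∑cuts F p) ≡
  ∑ (perms xs) (F p) + ∑ (selections xs) (λ (g , ys) → ∑ (perms ys) (∑cuts F (g ∷ p)))
∑-perms-∑cuts F p []          = sym (+-identityʳ _)
∑-perms-∑cuts F p xs@(x ∷ xs′) = begin
  ∑ (perms xs) (∑cuts F p)
    ≡⟨ ∑-perms-head _ x xs′ ⟩
  ∑ (selections xs) (λ (g , ys) → ∑ (perms ys) (λ ρ → F p (g ∷ ρ) + ∑cuts F (g ∷ p) ρ))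
    ≡⟨ ∑-cong (selections xs) (λ (g , ys) → ∑-distrib-+ _ _ (perms ys)) ⟩
  ∑ (selections xs) (λ (g , ys) → ∑ (perms ys) (F p ∘ (g ∷_)) + ∑ (perms ys) (∑cuts F (g ∷ p)))
    ≡⟨ ∑-distrib-+ (λ (g , ys) → ∑ (perms ys) (F p ∘ (g ∷_))) later (selections xs) ⟩
  ∑ (selections xs) (λ (g , ys) → ∑ (perms ys) (F p ∘ (g ∷_))) + ∑ (selections xs) later
    ≡⟨ cong (_+ ∑ (selections xs) later) (sym (∑-perms-head (F p) x xs′)) ⟩
  ∑ (perms xs) (F p) + ∑ (selections xs) later
    ∎
  where
  open ≡-Reasoning
  later : _ × List _ → ℕ
  later (g , ys) = ∑ (perms ys) (∑cuts F (g ∷ p))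

-- Marking an entry g of a permutation amounts to removing g and then choosing where to put it back
-- among the others. If some h comes first, `∑-selections-swap` lets g be removed before h.
∑-perms-∑splits : ∀ (F : A → List A → List A → ℕ) k p xs → length xs ≡ k →
  ∑ (perms xs) (∑splits F p) ≡ ∑ (selections xs) (λ (g , ys) → ∑ (perms ys) (∑cuts (F g) p))
∑-perms-∑splits F k p [] _ = refl
∑-perms-∑splits F (suc k) p xs@(x ∷ xs′) eq = begin
  ∑ (perms xs) (∑splits F p)
    ≡⟨ ∑-perms-head _ x xs′ ⟩
  ∑ (selections xs) (λ (g , ys) → ∑ (perms ys) (λ ρ → F g p ρ + ∑splits F (g ∷ p) ρ))
    ≡⟨ ∑-cong (selections xs) (λ (g , ys) → ∑-distrib-+ _ _ (perms ys)) ⟩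
  ∑ (selections xs) (λ (g , ys) → ∑ (perms ys) (F g p) + ∑ (perms ys) (∑splits F (g ∷ p)))
    ≡⟨ ∑-distrib-+ now (λ (g , ys) → ∑ (perms ys) (∑splits F (g ∷ p))) (selections xs) ⟩
  ∑now + ∑ (selections xs) (λ (g , ys) → ∑ (perms ys) (∑splits F (g ∷ p)))
    ≡⟨ cong (∑now +_) (∑-cong-∈ (selections xs) (λ (g , ys) q∈ →
         ∑-perms-∑splits F k (g ∷ p) ys
           (suc-injective (trans (sym (selections-length xs q∈)) eq)))) ⟩
  ∑now + ∑ (selections xs) (λ (h , ys) → ∑ (selections ys) (λ (g , zs) → ∑ (perms zs) (∑cuts (F g) (h ∷ p))))
    ≡⟨ cong (∑now +_) (∑-selections-swap (λ h g zs → ∑ (perms zs) (∑cuts (F g) (h ∷ p))) xs) ⟩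
  ∑now + ∑ (selections xs) (λ (g , ys) → ∑ (selections ys) (λ (h , zs) → ∑ (perms zs) (∑cuts (F g) (h ∷ p))))
    ≡⟨ sym (∑-distrib-+ now later (selections xs)) ⟩
  ∑ (selections xs) (λ (g , ys) → ∑ (perms ys) (F g p) +
    ∑ (selections ys) (λ (h , zs) → ∑ (perms zs) (∑cuts (F g) (h ∷ p))))
    ≡⟨ ∑-cong (selections xs) (λ (g , ys) → sym (∑-perms-∑cuts (F g) p ys)) ⟩
  ∑ (selections xs) (λ (g , ys) → ∑ (perms ys) (∑cuts (F g) p))
    ∎
  where
  open ≡-Reasoning
  now later : _ × List _ → ℕ
  now   (g , ys) = ∑ (perms ys) (F g p)
  later (g , ys) = ∑ (selections ys) (λ (h , zs) → ∑ (perms zs) (∑cuts (F g) (h ∷ p)))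
  ∑now : ℕ
  ∑now = ∑ (selections xs) now

-- Conditional summands.

when : Bool → ℕ → ℕ
when b t = if b then t else 0

∑cuts-distrib-+ : ∀ (F H : List A → List A → ℕ) p ρ →
  ∑cuts (λ q τ → F q τ + H q τ) p ρ ≡ ∑cuts F p ρ + ∑cuts H p ρ
∑cuts-distrib-+ F H p []      = refl
∑cuts-distrib-+ F H p (g ∷ ρ) =
  trans (cong (F p (g ∷ ρ) + H p (g ∷ ρ) +_) (∑cuts-distrib-+ F H (g ∷ p) ρ))
        (+-interchange (F p (g ∷ ρ)) (H p (g ∷ ρ)) _ _)

∑cuts-when : ∀ b (F : List A → List A → ℕ) p ρ →
  ∑cuts (λ q τ → when b (F q τ)) p ρ ≡ when b (∑cuts F p ρ)
∑cuts-when true  F p ρ       = refl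
∑cuts-when false F p []      = refl
∑cuts-when false F p (g ∷ ρ) = ∑cuts-when false F (g ∷ p) ρ

∑-when : ∀ b (f : A → ℕ) xs → ∑ xs (λ x → when b (f x)) ≡ when b (∑ xs f)
∑-when true  f xs = refl
∑-when false f xs = ∑-zero xs (λ _ → refl)

when-mono : ∀ b {s t} → s ≤ t → when b s ≤ when b t
when-mono true  s≤t = s≤t
when-mono false _   = z≤n

when-≤ : ∀ b t → when b t ≤ t
when-≤ true  t = ≤-refl
when-≤ false t = z≤n

∑-indicator : ∀ {k} (a : Fin k) c xs → Unique xs → a ∈ xs →
              ∑ xs (λ v → when (does (a ≟ v)) c) ≡ c
∑-indicator a c (x ∷ xs) (x∉ ∷ u) a∈ with a ≟ x | a∈
... | yes refl | _         = trans (cong (c +_) (absent xs (All¬⇒¬Any x∉))) (+-identityʳ c)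
  where
  absent : ∀ ys → a ∉ ys → ∑ ys (λ v → when (does (a ≟ v)) c) ≡ 0
  absent []       _  = refl
  absent (y ∷ ys) a∉ with a ≟ y
  ... | yes refl = ⊥-elim (a∉ (here refl))
  ... | no  _    = absent ys (a∉ ∘ there)
... | no a≢x   | here refl = ⊥-elim (a≢x refl)
... | no _     | there a∈′ = ∑-indicator a c xs u a∈′

-- Greedy matching, memo-free call counts and tokens.

module Greedy (G : Graph) where
  open Graph G
  -- `incident` and `other` are the same for every ordering; fixing the empty one lets all orderings
  -- share the counts below.
  open Oracle G [] using (incident; other)

  -- Prefixes of an ordering are stored with the edge of highest rank first.
  mutual
    matched : List (Fin m) → Fin n → Bool
    matched []      v = false
    matched (f ∷ p) v = matched p v ∨ (incident v f ∧ free p (other f v))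

    free : List (Fin m) → Fin n → Bool
    free p v = not (matched p v)

  -- Edge-oracle calls without memo table when only the edges of p exist.
  calls : List (Fin m) → Fin n → ℕ
  calls []      v = 0
  calls (f ∷ p) v = calls p v + when (incident v f) (when (free p v) (suc (calls p (other f v))))

  -- The tokens stemming from one at x, itself included, when ρ arrives after p.
  descendants : Fin n → List (Fin m) → List (Fin m) → ℕ
  descendants x p []      = 1
  descendants x p (g ∷ ρ) = descendants x (g ∷ p) ρ +
    when (incident x g) (when (free p (other g x)) (descendants (other g x) (g ∷ p) ρ))

  launch : Fin n → Fin m → List (Fin m) → List (Fin m) → ℕ
  launch u e p ρ = when (free p u) (descendants u (e ∷ p) ρ)

  extend : Fin n → Fin m → List (Fin m) → List (Fin m) → ℕ
  extend x g p ρ = when (incident x g) (launch (other g x) g p ρ)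

  -- Every further token stems from exactly one copy made by the original token itself; the sum
  -- groups tokens by the edge of that copy.
  descendants-∑splits : ∀ x p ρ → descendants x p ρ ≡ 1 + ∑splits (extend x) p ρ
  descendants-∑splits x p []      = refl
  descendants-∑splits x p (g ∷ ρ) =
    trans (cong (_+ extend x g p ρ) (descendants-∑splits x (g ∷ p) ρ))
          (cong suc (+-comm _ (extend x g p ρ)))

  -- A vertex once matched stays matched, so e launches nothing at u at any later position.
  ∑cuts-launch-dead : ∀ u e p ρ → matched p u ≡ true → ∑cuts (launch u e) p ρ ≡ 0
  ∑cuts-launch-dead u e p []      dead rewrite dead = refl
  ∑cuts-launch-dead u e p (g ∷ ρ) dead = cong₂ _+_
    (cong (λ b → when (not b) (descendants u (e ∷ p) (g ∷ ρ))) dead)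
    (∑cuts-launch-dead u e (g ∷ p) ρ (cong (_∨ (incident u g ∧ free p (other g u))) dead))

  open ≤-Reasoning

  -- The cuts insert e at every position, so the bound is an average of one token per ordering of k
  -- + 1 edges. The factor `free p u` is what the induction step needs to rule out double
  -- contributions.
  ∑-perms-launch : ∀ k xs p u e → length xs ≡ k →
    ∑ (perms xs) (∑cuts (launch u e) p) ≤ when (free p u) (suc k !)
  ∑-perms-launch zero    []  p u e eq = ≤-reflexive (+-identityʳ (when (free p u) 1))
  ∑-perms-launch (suc k) xs  p u e eq with matched p u in alive
  ... | true  = ≤-reflexive (∑-zero (perms xs) (λ ρ → ∑cuts-launch-dead u e p ρ alive))
  ... | false = begin
    ∑ (perms xs) (∑cuts (launch u e) p)
      ≡⟨ ∑-perms-∑cuts (launch u e) p xs ⟩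
    ∑ (perms xs) (launch u e p) + ∑ (selections xs) later
      ≡⟨ cong (_+ ∑ (selections xs) later) (∑-cong (perms xs) (λ ρ →
           trans (cong (λ b → when (not b) (descendants u (e ∷ p) ρ)) alive)
                 (descendants-∑splits u (e ∷ p) ρ))) ⟩
    ∑ (perms xs) (λ ρ → 1 + ∑splits (extend u) (e ∷ p) ρ) + ∑ (selections xs) later
      ≡⟨ cong (_+ ∑ (selections xs) later) (trans (∑-distrib-+ _ _ (perms xs))
           (cong₂ _+_ (∑-perms-one (suc k) xs eq)
                      (∑-perms-∑splits (extend u) (suc k) (e ∷ p) xs eq))) ⟩
    suc k ! + ∑ (selections xs) next + ∑ (selections xs) later
      -- In `next` e arrives first and g carries a copy; in `later` g arrives first. They are merged
      -- so that each g can be bounded jointly.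
      ≡⟨ trans (+-assoc (suc k !) _ _) (cong (suc k ! +_) (sym (∑-distrib-+ next later (selections xs)))) ⟩
    suc k ! + ∑ (selections xs) (λ q → next q + later q)
      ≤⟨ +-monoʳ-≤ (suc k !) (∑-mono-∈ (selections xs) bound) ⟩
    suc k ! + ∑ (selections xs) (λ _ → suc k !)
      ≡⟨ cong (suc k ! +_) (trans (∑-selections-const (suc k !) xs) (cong (_* suc k !) eq)) ⟩
    suc (suc k) !
      ∎
    where
    next later : Fin m × List (Fin m) → ℕ
    next  (g , ys) = ∑ (perms ys) (∑cuts (extend u g) (e ∷ p))
    later (g , ys) = ∑ (perms ys) (∑cuts (launch u e) (g ∷ p))

    -- Here a and b tell whether u and the other end of g are matched. A copy through g needs b
    -- false, while u stays free after an incident g only if b is true.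
    exclusive : ∀ a b i x t →
      when i (when (not (b ∨ x)) t) + when (not (a ∨ (i ∧ not b))) t ≤ t
    exclusive a     b     false x t = when-≤ _ t
    exclusive a     true  true  x t = when-≤ _ t
    exclusive true  false true  x t = ≤-trans (≤-reflexive (+-identityʳ _)) (when-≤ (not x) t)
    exclusive false false true  x t = ≤-trans (≤-reflexive (+-identityʳ _)) (when-≤ (not x) t)

    bound : ∀ q → q ∈ selections xs → next q + later q ≤ suc k !
    bound (g , ys) q∈ = begin
      next (g , ys) + later (g , ys)
        ≡⟨ cong (_+ later (g , ys)) (trans
             (∑-cong (perms ys) (∑cuts-when (incident u g) (launch (other g u) g) (e ∷ p)))
             (∑-when (incident u g) _ (perms ys))) ⟩
      when (incident u g) (∑ (perms ys) (∑cuts (launch (other g u) g) (e ∷ p))) + later (g , ys)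
        -- Two uses of induction: g launching at its other end after e, and e still to come after g.
        ≤⟨ +-mono-≤ (when-mono (incident u g) (∑-perms-launch k ys (e ∷ p) (other g u) g len))
                    (∑-perms-launch k ys (g ∷ p) u e len) ⟩
      when (incident u g) (when (free (e ∷ p) (other g u)) (suc k !)) + when (free (g ∷ p) u) (suc k !)
        ≤⟨ exclusive (matched p u) (matched p (other g u)) (incident u g) _ (suc k !) ⟩
      suc k !
        ∎
      where
      len : length ys ≡ k
      len = suc-injective (trans (sym (selections-length xs q∈)) eq)

  -- Token conservation and the sum of calls over all vertices.

  vertices : List (Fin n)
  vertices = allFin n

  -- Only the two ends of g contribute, and they are distinct by `noLoop`.
  ∑-ends : ∀ g (H : Fin n → Fin n → ℕ) →
    ∑ vertices (λ v → when (incident v g) (H v (other g v))) ≡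
    H (proj₁ (edge g)) (proj₂ (edge g)) + H (proj₂ (edge g)) (proj₁ (edge g))
  ∑-ends g H = let a = proj₁ (edge g) ; b = proj₂ (edge g) in
    trans (∑-cong vertices pointwise)
      (trans (∑-distrib-+ _ _ vertices)
        (cong₂ _+_ (∑-indicator a (H a b) vertices (allFin⁺ n) (∈-allFin a))
                   (∑-indicator b (H b a) vertices (allFin⁺ n) (∈-allFin b))))
    where
    pointwise : ∀ v → when (incident v g) (H v (other g v)) ≡
      when (does (proj₁ (edge g) ≟ v)) (H (proj₁ (edge g)) (proj₂ (edge g))) +
      when (does (proj₂ (edge g) ≟ v)) (H (proj₂ (edge g)) (proj₁ (edge g)))
    pointwise v with proj₁ (edge g) ≟ v | proj₂ (edge g) ≟ v
    ... | yes a≡v  | yes b≡v  = ⊥-elim (noLoop g (trans a≡v (sym b≡v)))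
    ... | yes refl | no _     = sym (+-identityʳ _)
    ... | no _     | yes refl = refl
    ... | no _     | no _     = refl

  births : Fin m → List (Fin m) → List (Fin m) → ℕ
  births g p ρ = launch (proj₁ (edge g)) g p ρ + launch (proj₂ (edge g)) g p ρ

  -- The final tokens descend either from the `calls p v` tokens present at v after p, or from
  -- launches by edges of ρ. Moving one edge from ρ to p only reattributes them.
  ∑-calls : ∀ p ρ → ∑ vertices (calls (ρ ʳ++ p)) ≡
                    ∑ vertices (λ v → calls p v * descendants v p ρ) + ∑splits births p ρ
  ∑-calls p []      = sym (trans (+-identityʳ _) (∑-cong vertices (λ v → *-identityʳ (calls p v))))
  ∑-calls p (g ∷ ρ) = begin-equality
    ∑ vertices (calls (ρ ʳ++ g ∷ p))
      ≡⟨ ∑-calls (g ∷ p) ρ ⟩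
    ∑ vertices (λ v → calls (g ∷ p) v * d v) + tail
      ≡⟨ cong (_+ tail) (∑-cong vertices (λ v → split (incident v g) (free p v) (k v) (suc (k (other g v))) (d v))) ⟩
    ∑ vertices (λ v → k v * d v + when (incident v g) (inflow v (other g v))) + tail
      ≡⟨ cong (_+ tail) (trans (∑-distrib-+ _ _ vertices) (cong (old +_) (∑-ends g inflow))) ⟩
    old + (inflow a b + inflow b a) + tail
      ≡⟨ cong (λ t → old + t + tail) (trans (cong₂ _+_ (flow a b) (flow b a)) (rearrange (launch a g p ρ) (outflow b a) (launch b g p ρ) (outflow a b))) ⟩
    old + ((outflow a b + outflow b a) + births g p ρ) + tail
      ≡⟨ trans (cong (_+ tail) (sym (+-assoc old _ (births g p ρ)))) (+-assoc (old + _) (births g p ρ) tail) ⟩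
    old + (outflow a b + outflow b a) + ∑splits births p (g ∷ ρ)
      ≡⟨ cong (_+ ∑splits births p (g ∷ ρ)) (sym (trans (∑-distrib-+ _ _ vertices) (cong (old +_) (∑-ends g outflow)))) ⟩
    ∑ vertices (λ v → k v * d v + when (incident v g) (outflow v (other g v))) + ∑splits births p (g ∷ ρ)
      ≡⟨ cong (_+ ∑splits births p (g ∷ ρ)) (∑-cong vertices (λ v → sym (merge (incident v g) (free p (other g v)) (k v) (d v) _))) ⟩
    ∑ vertices (λ v → calls p v * descendants v p (g ∷ ρ)) + ∑splits births p (g ∷ ρ)
      ∎
    where
    k d : Fin n → ℕ
    k = calls p
    d v = descendants v (g ∷ p) ρ
    a b : Fin n
    a = proj₁ (edge g)
    b = proj₂ (edge g)
    tail old : ℕ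
    tail = ∑splits births (g ∷ p) ρ
    old = ∑ vertices (λ v → k v * d v)
    inflow outflow : Fin n → Fin n → ℕ
    inflow  v w = when (free p v) (suc (k w) * d v)
    outflow v w = when (free p w) (k v * d w)

    split : ∀ i φ s t c → (s + when i (when φ t)) * c ≡ s * c + when i (when φ (t * c))
    split true  true  s t c = *-distribʳ-+ c s t
    split true  false s t c = trans (cong (_* c) (+-identityʳ s)) (sym (+-identityʳ _))
    split false _     s t c = trans (cong (_* c) (+-identityʳ s)) (sym (+-identityʳ _))

    merge : ∀ i φ s c t → s * (c + when i (when φ t)) ≡ s * c + when i (when φ (s * t))
    merge true  true  s c t = *-distribˡ-+ s c t
    merge true  false s c t = trans (cong (s *_) (+-identityʳ c)) (sym (+-identityʳ _))
    merge false _     s c t = trans (cong (s *_) (+-identityʳ c)) (sym (+-identityʳ _))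

    -- Of the `suc (k w)` tokens appearing at v, one is launched by g and the others are copies of
    -- those at w.
    flow : ∀ v w → inflow v w ≡ launch v g p ρ + outflow w v
    flow v w with free p v
    ... | true  = refl
    ... | false = refl

    rearrange : ∀ s t s′ t′ → (s + t) + (s′ + t′) ≡ (t′ + t) + (s + s′)
    rearrange s t s′ t′ = trans (+-interchange s t s′ t′)
      (trans (+-comm (s + s′) (t + t′)) (cong (_+ (s + s′)) (+-comm t t′)))

  ∑-perms-calls : ∀ xs → ∑ (perms xs) (λ ρ → ∑ vertices (calls (ρ ʳ++ []))) ≤
                         2 * length xs * length xs !
  ∑-perms-calls []             = ≤-reflexive (trans (+-identityʳ _) (∑-zero vertices (λ _ → refl)))
  ∑-perms-calls xs@(_ ∷ xs′) = begin
    ∑ (perms xs) (λ ρ → ∑ vertices (calls (ρ ʳ++ [])))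
      -- No token exists before the first arrival, so only births remain.
      ≡⟨ ∑-cong (perms xs) (λ ρ → trans (∑-calls [] ρ) (cong (_+ ∑splits births [] ρ) (∑-zero vertices (λ _ → refl)))) ⟩
    ∑ (perms xs) (∑splits births [])
      ≡⟨ ∑-perms-∑splits births (length xs) [] xs refl ⟩
    ∑ (selections xs) (λ (g , ys) → ∑ (perms ys) (∑cuts (births g) []))
      ≤⟨ ∑-mono-∈ (selections xs) (λ (g , ys) q∈ → ≤-trans
           (≤-reflexive (trans (∑-cong (perms ys) (∑cuts-distrib-+ _ _ [])) (∑-distrib-+ _ _ (perms ys))))
           (+-mono-≤ (∑-perms-launch (length xs′) ys [] _ g (suc-injective (sym (selections-length xs q∈))))
                     (∑-perms-launch (length xs′) ys [] _ g (suc-injective (sym (selections-length xs q∈)))))) ⟩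
    ∑ (selections xs) (λ _ → length xs ! + length xs !)
      ≡⟨ ∑-selections-const _ xs ⟩
    length xs * (length xs ! + length xs !)
      ≡⟨ cong (λ t → length xs * (length xs ! + t)) (sym (+-identityʳ _)) ⟩
    length xs * (2 * length xs !)
      ≡⟨ trans (sym (*-assoc (length xs) 2 (length xs !))) (cong (_* (length xs !)) (*-comm (length xs) 2)) ⟩
    2 * length xs * length xs !
      ∎

-- Enumerated orderings are rearrangements of the edge list.

insertions-↭ : ∀ (x : A) ρ {σ} → σ ∈ insertions x ρ → x ∷ ρ ↭ σ
insertions-↭ x []      (here refl) = ↭-refl
insertions-↭ x (y ∷ ρ) (here refl) = ↭-refl
insertions-↭ x (y ∷ ρ) (there σ∈) with ∈-map⁻ (y ∷_) σ∈
... | τ , τ∈ , refl = ↭-trans (swap x y ↭-refl) (prep y (insertions-↭ x ρ τ∈))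

perms-↭ : ∀ (xs : List A) {σ} → σ ∈ perms xs → xs ↭ σ
perms-↭ []       (here refl) = ↭-refl
perms-↭ (x ∷ xs) σ∈ with find (∈-concatMap⁻ (insertions x) {xs = perms xs} σ∈)
... | ρ , ρ∈ , σ∈ρ = ↭-trans (prep x (perms-↭ xs ρ∈)) (insertions-↭ x ρ σ∈ρ)

-- Comparison of the memoised oracle with the memo-free count.

module Memoised (G : Graph) (ord : Ordering G) (unique : Unique ord) where
  open Graph G
  open Oracle G ord
  open Greedy G using (matched; free; calls)

  earlier : Fin m → List (Fin m)
  earlier e = reverse (before e ord)

  before-prefix : ∀ e xs → Σ (List (Fin m)) (λ ys → xs ≡ before e xs ++ ys)
  before-prefix e []       = [] , refl
  before-prefix e (f ∷ fs) with f ≟ e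
  ... | yes _ = f ∷ fs , refl
  ... | no  _ = let ys , eq = before-prefix e fs in ys , cong (f ∷_) eq

  before-++ : ∀ e xs {ys} → Unique (xs ++ e ∷ ys) → before e (xs ++ e ∷ ys) ≡ xs
  before-++ e []       _ with e ≟ e
  ... | yes _  = refl
  ... | no e≢e = ⊥-elim (e≢e refl)
  before-++ e (x ∷ xs) (x∉ ∷ u) with x ≟ e
  ... | yes refl = ⊥-elim (All¬⇒¬Any x∉ (∈-++⁺ʳ xs (here refl)))
  ... | no  _    = cong (x ∷_) (before-++ e xs u)

  before-ord : ∀ q e rest → ord ≡ q ʳ++ (e ∷ rest) → before e ord ≡ reverse q
  before-ord q e rest eq = trans (cong (before e) split)
    (before-++ e (reverse q) (subst Unique split unique))
    where split = trans eq (ʳ++-defn q)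

  -- The correct answer for e and u is whether u is still unmatched just before e arrives.
  Consistent : Memo → Set
  Consistent M = ∀ e u b → lookupMemo e u M ≡ just b → b ≡ free (earlier e) u

  consistent-∷ : ∀ {e u b M} → b ≡ free (earlier e) u → Consistent M → Consistent ((e , u , b) ∷ M)
  consistent-∷ {e} {u} b≡ C e′ u′ b′ eq with e ≟ e′ | u ≟ u′
  consistent-∷ b≡ C _ _ _ refl | yes refl | yes refl = b≡
  ... | yes _ | no  _ = C e′ u′ b′ eq
  ... | no  _ | _     = C e′ u′ b′ eq

  -- The answer is exact, but the count is only bounded above, since a stored answer costs a single
  -- call.
  EoSpec : Fin m → Fin n → Bool × Memo × ℕ → Set
  EoSpec e u (b , M , c) = b ≡ free (earlier e) u × Consistent M × c ≤ suc (calls (earlier e) u)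

  -- q is the part of the ordering already passed; `calls q u` accounts for it, so that bounds for
  -- successive edges compose.
  LoopSpec : List (Fin m) → List (Fin m) → Fin n → Bool × Memo × ℕ → Set
  LoopSpec q fs u (b , M , c) =
    b ≡ matched (fs ʳ++ q) u × Consistent M × calls q u + c ≤ calls (fs ʳ++ q) u

  matched-ʳ++ : ∀ fs q u → matched q u ≡ true → matched (fs ʳ++ q) u ≡ true
  matched-ʳ++ []       q u eq = eq
  matched-ʳ++ (f ∷ fs) q u eq =
    matched-ʳ++ fs (f ∷ q) u (cong (_∨ (incident u f ∧ free q (other f u))) eq)

  calls-ʳ++ : ∀ fs q u → calls q u ≤ calls (fs ʳ++ q) u
  calls-ʳ++ []       q u = ≤-refl
  calls-ʳ++ (f ∷ fs) q u = ≤-trans (m≤m+n _ _) (calls-ʳ++ fs (f ∷ q) u)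

  matched-skip : ∀ f q u → incident u f ≡ false → matched (f ∷ q) u ≡ matched q u
  matched-skip f q u eq = trans
    (cong (λ i → matched q u ∨ (i ∧ free q (other f u))) eq) (∨-identityʳ _)

  calls-skip : ∀ f q u → incident u f ≡ false → calls (f ∷ q) u ≡ calls q u
  calls-skip f q u eq = trans
    (cong (λ i → calls q u + when i (when (free q u) (suc (calls q (other f u))))) eq) (+-identityʳ _)

  matched-scan : ∀ f q u → incident u f ≡ true → matched q u ≡ false →
                 matched (f ∷ q) u ≡ free q (other f u)
  matched-scan f q u inc alive = cong₂ (λ b i → b ∨ (i ∧ free q (other f u))) alive inc

  calls-scan : ∀ f q u → incident u f ≡ true → matched q u ≡ false →
               calls (f ∷ q) u ≡ calls q u + suc (calls q (other f u))
  calls-scan f q u inc alive =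
    cong₂ (λ b i → calls q u + when i (when (not b) (suc (calls q (other f u))))) alive inc

  mutual
    -- Fuel above the number of earlier edges excludes the default answer for exhausted fuel.
    eo-spec : ∀ k e u M → length (before e ord) < k → Consistent M → EoSpec e u (eo k e u M)
    eo-spec k e u M lt C with lookupMemo e u M in eq
    ... | just b = C e u b eq , C , s≤s z≤n
    eo-spec (suc k) e u M (s≤s le) C | nothing
      with loop k (filterᵇ (incident u) (before e ord)) u M
         | loop-spec k [] (before e ord) (proj₁ (before-prefix e ord)) u M
                     (proj₂ (before-prefix e ord)) le refl C
    ... | found , M′ , c | found≡ , C′ , c≤ =
      cong not found≡ , consistent-∷ {M = M′} (cong not found≡) C′ , s≤s c≤

    -- The loop goes on only while u is unmatched; then an incident f matches u exactly when its
    -- other end is free, which is what the oracle call reports.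
    loop-spec : ∀ k q fs rest u M → ord ≡ q ʳ++ (fs ++ rest) → length q + length fs ≤ k →
                matched q u ≡ false → Consistent M →
                LoopSpec q fs u (loop k (filterᵇ (incident u) fs) u M)
    loop-spec k q []       rest u M split le alive C =
      sym alive , C , ≤-reflexive (+-identityʳ _)
    loop-spec k q (f ∷ fs) rest u M split le alive C = step
      where
      le′ : suc (length q) + length fs ≤ k
      le′ = ≤-trans (≤-reflexive (sym (+-suc (length q) (length fs)))) le

      shallow : length (before f ord) < k
      shallow = begin-strict
        length (before f ord)     ≡⟨ cong length (before-ord q f (fs ++ rest) split) ⟩
        length (reverse q)        ≡⟨ length-reverse q ⟩
        length q                  ≤⟨ m≤m+n (length q) (length fs) ⟩
        length q + length fs      <⟨ le′ ⟩
        k                         ∎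
        where open ≤-Reasoning

      earlier≡ : earlier f ≡ q
      earlier≡ = trans (cong reverse (before-ord q f (fs ++ rest) split)) (reverse-involutive q)

      matched≡ : ∀ {b} → b ≡ free (earlier f) (other f u) → incident u f ≡ true →
                 matched (f ∷ q) u ≡ b
      matched≡ b≡ inc = trans (matched-scan f q u inc alive)
        (sym (trans b≡ (cong (λ p → free p (other f u)) earlier≡)))

      calls≤ : ∀ {c} → c ≤ suc (calls (earlier f) (other f u)) → incident u f ≡ true →
               calls q u + c ≤ calls (f ∷ q) u
      calls≤ {c} c≤ inc = begin
        calls q u + c                                   ≤⟨ +-monoʳ-≤ (calls q u) c≤ ⟩
        calls q u + suc (calls (earlier f) (other f u)) ≡⟨ cong (λ p → calls q u + suc (calls p (other f u))) earlier≡ ⟩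
        calls q u + suc (calls q (other f u))           ≡⟨ calls-scan f q u inc alive ⟨
        calls (f ∷ q) u                                 ∎
        where open ≤-Reasoning

      step : LoopSpec q (f ∷ fs) u (loop k (filterᵇ (incident u) (f ∷ fs)) u M)
      step with incident u f in inc
      step | false
        with loop k (filterᵇ (incident u) fs) u M
           | loop-spec k (f ∷ q) fs rest u M split le′ (trans (matched-skip f q u inc) alive) C
      ... | b , M′ , c | b≡ , C′ , c≤ =
        b≡ , C′ , subst (λ t → t + c ≤ calls (fs ʳ++ f ∷ q) u) (calls-skip f q u inc) c≤
      step | true
        with eo k f (other f u) M | eo-spec k f (other f u) M shallow C
      -- The loop stops here; over the rest of the edges u stays matched and `calls` cannot
      -- decrease.
      ... | true , M₁ , c₁ | b₁≡ , C₁ , c₁≤ =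
        sym (matched-ʳ++ fs (f ∷ q) u (matched≡ b₁≡ inc)) , C₁ ,
        ≤-trans (calls≤ c₁≤ inc) (calls-ʳ++ fs (f ∷ q) u)
      ... | false , M₁ , c₁ | b₁≡ , C₁ , c₁≤
        with loop k (filterᵇ (incident u) fs) u M₁
           | loop-spec k (f ∷ q) fs rest u M₁ split le′ (matched≡ b₁≡ inc) C₁
      ... | b₂ , M₂ , c₂ | b₂≡ , C₂ , c₂≤ = b₂≡ , C₂ , (begin
        calls q u + (c₁ + c₂)     ≡⟨ +-assoc (calls q u) c₁ c₂ ⟨
        calls q u + c₁ + c₂       ≤⟨ +-monoˡ-≤ c₂ (calls≤ c₁≤ inc) ⟩
        calls (f ∷ q) u + c₂      ≤⟨ c₂≤ ⟩
        calls (fs ʳ++ f ∷ q) u    ∎)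
        where open ≤-Reasoning

  T≤calls : ∀ v → length ord ≡ m → T v ≤ calls (reverse ord) v
  -- Initially nothing is scanned, and the empty memo is consistent vacuously.
  T≤calls v len = proj₂ (proj₂ (loop-spec (suc m) [] ord [] v [] (sym (++-identityʳ ord))
    (≤-trans (≤-reflexive len) (n≤1+n m)) refl (λ _ _ _ ())))

-- The final bound and its logarithmic factor.

1≤log₂ : ∀ {k} (a b : Fin k) → a ≢ b → 1 ≤ ⌈log₂ k ⌉
1≤log₂ {suc zero}    fzero fzero a≢b = ⊥-elim (a≢b refl)
1≤log₂ {suc (suc k)} _     _     _   = ⌈log₂⌉-mono-≤ {2} {suc (suc k)} (s≤s (s≤s z≤n))

totalCalls-≤ : ∀ G → totalCalls G ≤ 2 * Graph.m G * (Graph.m G) !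
totalCalls-≤ G = begin
  totalCalls G
    ≤⟨ ∑-mono-∈ (perms (allFin m)) (λ ord ord∈ →
         let allFin↭ord = perms-↭ (allFin m) ord∈ in
         ∑-mono vertices (λ v → Memoised.T≤calls G ord
           (Unique-resp-↭ (setoid _) (↭⇒↭ₛ allFin↭ord) (allFin⁺ m)) v
           (trans (sym (↭-length allFin↭ord)) (length-tabulate id)))) ⟩
  ∑ (perms (allFin m)) (λ ord → ∑ vertices (calls (reverse ord)))
    ≤⟨ ∑-perms-calls (allFin m) ⟩
  2 * length (allFin m) * length (allFin m) !
    ≡⟨ cong (λ k → 2 * k * k !) (length-tabulate {n = m} id) ⟩
  2 * m * m !
    ∎
  where
  open Graph G using (m)
  open Greedy G
  open ≤-Reasoning

-- `totalCalls` is n · m! times the expectation, and n times the average degree is 2m: this is the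
-- claim with denominators cleared.
theorem3p5 : Σ ℕ (λ C → (G : Graph) →
    totalCalls G ≤ C * (2 * Graph.m G) * (Graph.m G) ! * ⌈log₂ Graph.n G ⌉)
theorem3p5 = 1 , λ G → ≤-trans (totalCalls-≤ G)
  (insert-log (Graph.m G) (λ e → 1≤log₂ _ _ (Graph.noLoop G e)))
  where
  -- Without edges the left side is 0; otherwise the distinct ends of an edge force the logarithm to
  -- be at least 1.
  insert-log : ∀ k {l} → (Fin k → 1 ≤ l) → 2 * k * k ! ≤ 1 * (2 * k) * k ! * l
  insert-log zero        1≤l = z≤n
  insert-log k@(suc _) {l} 1≤l = begin
    2 * k * k !               ≡⟨ *-identityʳ (2 * k * k !) ⟨
    2 * k * k ! * 1           ≤⟨ *-monoʳ-≤ (2 * k * k !) (1≤l fzero) ⟩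
    2 * k * k ! * l           ≡⟨ cong (λ t → t * k ! * l) (*-identityˡ (2 * k)) ⟨
    1 * (2 * k) * k ! * l     ∎
    where open ≤-Reasoning
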